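{- For every even integer $d \ge 2$ and every $n \in \mathbb{N}^*$, the SONC cone $C_{n,d}$ is not closed under multiplication in the following sense: there exist $p_1,p_2 \in C_{n,d}$ such that $p_1\cdot p_2 \notin C_{n,2d}$.
   Context: $\mathbb{N}$ contains $0$ and $\mathbb{N}^* = \mathbb{N}\setminus\{0\}$. A circuit polynomial is a polynomial $f(\mathbf{x}) = \sum_{j=0}^r f_{\boldsymbol{\alpha}(j)} \mathbf{x}^{\boldsymbol{\alpha}(j)} + f_{\boldsymbol{\beta}} \mathbf{x}^{\boldsymbol{\beta}}$ in $\mathbb{R}[x_1,\dots,x_n]$ with $0\le r \le n$, exponents $\boldsymbol{\alpha}(j),\boldsymbol{\beta} \in \mathbb{N}^n$, $f_{\boldsymbol{\alpha}(j)} > 0$, $f_{\boldsymbol{\beta}} \in \mathbb{R}$, such that $\boldsymbol{\alpha}(0),\dots,\boldsymbol{\alpha}(r)$ lie in $(2\mathbb{N})^n$ and are affinely independent (so they are the vertices of a simplex), and $\boldsymbol{\beta}$ lies in the relative interior of that simplex. In particular, monomial squares $c\,\mathbf{x}^{\boldsymbol{\alpha}}$ with $c>0$ and $\boldsymbol{\alpha} \in (2\mathbb{N})^n$ count as (nonnegative) circuit polynomials. A circuit polynomial is nonnegative if it is nonnegative on all of $\mathbb{R}^n$. For even $D \ge 2$, $C_{n,D}$ is the set of SONC polynomials in $n$ variables of degree at most $D$: all $f=\sum_{i=1}^k \mu_i q_i$ of degree at most $D$ with $k\in\mathbb{N}^*$, $\mu_i \ge 0$ and $q_i$ nonnegative circuit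 polynomials. -}

module Defs where

open import Level using (0ℓ)
open import Algebra.Bundles using (CommutativeRing; Semiring)
open import Data.Fin.Base using (Fin)
open import Data.List.Base as List using (List; []; _∷_; _++_; cartesianProductWith)
open import Data.Nat.Base as ℕ using (ℕ; suc)
import Data.Nat.Properties as ℕₚ
open import Data.Nat.Divisibility using (_∣_)
open import Data.Integer.Base using (+_)
open import Data.Product.Base using (∃; _×_; _,_)
open import Data.Rational.Base as ℚ using (ℚ; 0ℚ; 1ℚ; ½; ∣_∣)
import Data.Rational.Properties as ℚₚ
open import Data.Rational.Solver using (module +-*-Solver)
open import Data.Vec.Base as Vec using (Vec)
import Data.Vec.Properties as Vecₚ
open import Data.Vec.Functional using (Vector)
open import Relation.Binary.PropositionalEquality
open import Relation.Nullary using (yes; no)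

------------------------------------------------------------------------
-- The reals are Cauchy sequences of rationals, carrying a modulus of
-- convergence and identified up to _≃_.

Eventually : (ℕ → Set) → Set
Eventually P = ∃ λ N → ∀ n → N ℕ.≤ n → P n

record ℝ : Set where
  constructor mkℝ
  field
    seq    : ℕ → ℚ
    cauchy : ∀ ε → 0ℚ ℚ.< ε →
             ∃ λ N → ∀ m n → N ℕ.≤ m → N ℕ.≤ n → ∣ seq m ℚ.- seq n ∣ ℚ.≤ ε

open ℝ public

infix 4 _≃_ _≤_ _<_

_≃_ : ℝ → ℝ → Set
x ≃ y = ∀ ε → 0ℚ ℚ.< ε → Eventually λ n → ∣ seq x n ℚ.- seq y n ∣ ℚ.≤ ε

_≤_ : ℝ → ℝ → Set
x ≤ y = ∀ ε → 0ℚ ℚ.< ε → Eventually λ n → seq x n ℚ.≤ seq y n ℚ.+ ε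

_<_ : ℝ → ℝ → Set
x < y = ∃ λ ε → 0ℚ ℚ.< ε × Eventually λ n → seq x n ℚ.+ ε ℚ.≤ seq y n

open +-*-Solver

abstract
  half-pos : ∀ {ε} → 0ℚ ℚ.< ε → 0ℚ ℚ.< ½ ℚ.* ε
  half-pos {ε} 0<ε = ℚₚ.*-monoʳ-<-pos ½ 0<ε

  halves : ∀ ε → ½ ℚ.* ε ℚ.+ ½ ℚ.* ε ≡ ε
  halves ε = trans (sym (ℚₚ.*-distribʳ-+ ε ½ ½)) (ℚₚ.*-identityˡ ε)

  self-close : ∀ {ε} q → 0ℚ ℚ.< ε → ∣ q ℚ.- q ∣ ℚ.≤ ε
  self-close {ε} q 0<ε =
    subst (λ t → ∣ t ∣ ℚ.≤ ε) (sym (ℚₚ.+-inverseʳ q)) (ℚₚ.<⇒≤ 0<ε)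

  close-sym : ∀ {ε} p q → ∣ p ℚ.- q ∣ ℚ.≤ ε → ∣ q ℚ.- p ∣ ℚ.≤ ε
  close-sym {ε} p q = subst (ℚ._≤ ε) (trans (sym (ℚₚ.∣-p∣≡∣p∣ (p ℚ.- q)))
    (cong ∣_∣ (solve 2 (λ p q → :- (p :- q) := q :- p) refl p q)))

  neg-close : ∀ {ε} p q → ∣ p ℚ.- q ∣ ℚ.≤ ε → ∣ ℚ.- p ℚ.- ℚ.- q ∣ ℚ.≤ ε
  neg-close {ε} p q h = subst (λ t → ∣ t ∣ ℚ.≤ ε)
    (solve 2 (λ p q → q :- p := :- p :- (:- q)) refl p q) (close-sym p q h)

  sum-close : ∀ {ε} u v → ∣ u ∣ ℚ.≤ ½ ℚ.* ε → ∣ v ∣ ℚ.≤ ½ ℚ.* ε → ∣ u ℚ.+ v ∣ ℚ.≤ ε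
  sum-close {ε} u v hu hv = ℚₚ.≤-trans (ℚₚ.∣p+q∣≤∣p∣+∣q∣ u v)
    (subst (∣ u ∣ ℚ.+ ∣ v ∣ ℚ.≤_) (halves ε) (ℚₚ.+-mono-≤ hu hv))

  +-close : ∀ {ε} a b c d → ∣ a ℚ.- c ∣ ℚ.≤ ½ ℚ.* ε → ∣ b ℚ.- d ∣ ℚ.≤ ½ ℚ.* ε →
            ∣ (a ℚ.+ b) ℚ.- (c ℚ.+ d) ∣ ℚ.≤ ε
  +-close {ε} a b c d h k = subst (λ t → ∣ t ∣ ℚ.≤ ε)
    (solve 4 (λ a b c d → (a :- c) :+ (b :- d) := (a :+ b) :- (c :+ d)) refl a b c d)
    (sum-close (a ℚ.- c) (b ℚ.- d) h k)

  trans-close : ∀ {ε} a b c → ∣ a ℚ.- b ∣ ℚ.≤ ½ ℚ.* ε → ∣ b ℚ.- c ∣ ℚ.≤ ½ ℚ.* ε →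
                ∣ a ℚ.- c ∣ ℚ.≤ ε
  trans-close {ε} a b c h k = subst (λ t → ∣ t ∣ ℚ.≤ ε)
    (solve 3 (λ a b c → (a :- b) :+ (b :- c) := a :- c) refl a b c)
    (sum-close (a ℚ.- b) (b ℚ.- c) h k)

  bound : ∀ x → ∃ λ B → 0ℚ ℚ.< B × Eventually λ n → ∣ seq x n ∣ ℚ.≤ B
  bound x with cauchy x 1ℚ (ℚₚ.positive⁻¹ 1ℚ)
  ... | N , h = 1ℚ ℚ.+ ∣ seq x N ∣
              , ℚₚ.+-mono-<-≤ (ℚₚ.positive⁻¹ 1ℚ) (ℚₚ.0≤∣p∣ (seq x N))
              , N
              , λ n N≤n → ℚₚ.≤-trans
                  (subst (λ t → ∣ t ∣ ℚ.≤ ∣ seq x n ℚ.- seq x N ∣ ℚ.+ ∣ seq x N ∣)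
                    (solve 2 (λ a b → (a :- b) :+ b := a) refl (seq x n) (seq x N))
                    (ℚₚ.∣p+q∣≤∣p∣+∣q∣ (seq x n ℚ.- seq x N) (seq x N)))
                  (ℚₚ.+-monoˡ-≤ ∣ seq x N ∣ (h n N N≤n ℕₚ.≤-refl))

  quotient : ∀ {ε B} → 0ℚ ℚ.< ε → 0ℚ ℚ.< B → ∃ λ δ → 0ℚ ℚ.< δ × B ℚ.* δ ≡ ε
  quotient {ε} {B} 0<ε 0<B = (ℚ.1/ B) ℚ.* ε , 0<δ , eq
    where
    instance
      B-pos : ℚ.Positive B
      B-pos = ℚ.positive 0<B
      B-nonZero : ℚ.NonZero B
      B-nonZero = ℚₚ.pos⇒nonZero B
      1/B-pos : ℚ.Positive (ℚ.1/ B)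
      1/B-pos = ℚₚ.1/pos⇒pos B
    0<δ : 0ℚ ℚ.< (ℚ.1/ B) ℚ.* ε
    0<δ = subst (ℚ._< (ℚ.1/ B) ℚ.* ε) (ℚₚ.*-zeroʳ (ℚ.1/ B)) (ℚₚ.*-monoʳ-<-pos (ℚ.1/ B) 0<ε)
    eq : B ℚ.* ((ℚ.1/ B) ℚ.* ε) ≡ ε
    eq = trans (sym (ℚₚ.*-assoc B (ℚ.1/ B) ε))
           (trans (cong (ℚ._* ε) (ℚₚ.*-inverseʳ B)) (ℚₚ.*-identityˡ ε))

  scale-close : ∀ {B δ} u v → 0ℚ ℚ.< B → ∣ u ∣ ℚ.≤ B → ∣ v ∣ ℚ.≤ δ → ∣ u ℚ.* v ∣ ℚ.≤ B ℚ.* δ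
  scale-close {B} {δ} u v 0<B hu hv = subst (ℚ._≤ B ℚ.* δ) (sym (ℚₚ.∣p*q∣≡∣p∣*∣q∣ u v))
    (ℚₚ.≤-trans
      (ℚₚ.*-monoʳ-≤-nonNeg ∣ v ∣ {{ℚ.nonNegative (ℚₚ.0≤∣p∣ v)}} hu)
      (ℚₚ.*-monoˡ-≤-nonNeg B {{ℚ.nonNegative (ℚₚ.<⇒≤ 0<B)}} hv))

  *-close : ∀ {ε A B δ δ′} a b c d → 0ℚ ℚ.< A → 0ℚ ℚ.< B →
            A ℚ.* δ ≡ ½ ℚ.* ε → B ℚ.* δ′ ≡ ½ ℚ.* ε →
            ∣ b ∣ ℚ.≤ A → ∣ c ∣ ℚ.≤ B → ∣ a ℚ.- c ∣ ℚ.≤ δ → ∣ b ℚ.- d ∣ ℚ.≤ δ′ →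
            ∣ a ℚ.* b ℚ.- c ℚ.* d ∣ ℚ.≤ ε
  *-close {ε} a b c d 0<A 0<B eA eB hb hc h k = subst (λ t → ∣ t ∣ ℚ.≤ ε)
    (solve 4 (λ a b c d → b :* (a :- c) :+ c :* (b :- d) := a :* b :- c :* d) refl a b c d)
    (sum-close (b ℚ.* (a ℚ.- c)) (c ℚ.* (b ℚ.- d))
      (subst (∣ b ℚ.* (a ℚ.- c) ∣ ℚ.≤_) eA (scale-close b (a ℚ.- c) 0<A hb h))
      (subst (∣ c ℚ.* (b ℚ.- d) ∣ ℚ.≤_) eB (scale-close c (b ℚ.- d) 0<B hc k)))

  ⊔-left : ∀ {a b n} → a ℕ.⊔ b ℕ.≤ n → a ℕ.≤ n
  ⊔-left {a} {b} = ℕₚ.m⊔n≤o⇒m≤o a b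

  ⊔-right : ∀ {a b n} → a ℕ.⊔ b ℕ.≤ n → b ℕ.≤ n
  ⊔-right {a} {b} = ℕₚ.m⊔n≤o⇒n≤o a b

infixl 6 _+_
infixl 7 _*_
infix  8 -_

fromℚ : ℚ → ℝ
fromℚ q = mkℝ (λ _ → q) (λ ε 0<ε → 0 , λ _ _ _ _ → self-close q 0<ε)

0# 1# : ℝ
0# = fromℚ 0ℚ
1# = fromℚ 1ℚ

fromℕ : ℕ → ℝ
fromℕ k = fromℚ ((+ k) ℚ./ 1)

_+_ : ℝ → ℝ → ℝ
seq (x + y) n = seq x n ℚ.+ seq y n
cauchy (x + y) ε 0<ε
  with cauchy x (½ ℚ.* ε) (half-pos 0<ε) | cauchy y (½ ℚ.* ε) (half-pos 0<ε)
... | M , h | N , k = M ℕ.⊔ N , λ m n M⊔N≤m M⊔N≤n →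
  +-close (seq x m) (seq y m) (seq x n) (seq y n)
    (h m n (⊔-left M⊔N≤m) (⊔-left M⊔N≤n))
    (k m n (⊔-right {M} M⊔N≤m) (⊔-right {M} M⊔N≤n))

-_ : ℝ → ℝ
seq (- x) n = ℚ.- seq x n
cauchy (- x) ε 0<ε with cauchy x ε 0<ε
... | N , h = N , λ m n N≤m N≤n → neg-close (seq x m) (seq x n) (h m n N≤m N≤n)

_*_ : ℝ → ℝ → ℝ
seq (x * y) n = seq x n ℚ.* seq y n
cauchy (x * y) ε 0<ε =
  let B , 0<B , K , hB = bound x
      A , 0<A , L , hA = bound y
      δ  , 0<δ  , eA = quotient (half-pos 0<ε) 0<A
      δ′ , 0<δ′ , eB = quotient (half-pos 0<ε) 0<B
      M , h = cauchy x δ 0<δ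
      N , k = cauchy y δ′ 0<δ′
  in (K ℕ.⊔ L) ℕ.⊔ (M ℕ.⊔ N) , λ m n ≤m ≤n →
    *-close (seq x m) (seq y m) (seq x n) (seq y n) 0<A 0<B eA eB
      (hA m (⊔-right {K} (⊔-left ≤m)))
      (hB n (⊔-left (⊔-left ≤n)))
      (h m n (⊔-left (⊔-right {K ℕ.⊔ L} ≤m)) (⊔-left (⊔-right {K ℕ.⊔ L} ≤n)))
      (k m n (⊔-right {M} (⊔-right {K ℕ.⊔ L} ≤m)) (⊔-right {M} (⊔-right {K ℕ.⊔ L} ≤n)))

pointwise : ∀ x y → (∀ n → seq x n ≡ seq y n) → x ≃ y
pointwise x y h ε 0<ε = 0 , λ n _ →
  subst (λ t → ∣ seq x n ℚ.- t ∣ ℚ.≤ ε) (h n) (self-close (seq x n) 0<ε)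

≃-sym : ∀ {x y} → x ≃ y → y ≃ x
≃-sym {x} {y} e ε 0<ε with e ε 0<ε
... | N , h = N , λ n N≤n → close-sym (seq x n) (seq y n) (h n N≤n)

≃-trans : ∀ {x y z} → x ≃ y → y ≃ z → x ≃ z
≃-trans {x} {y} {z} e f ε 0<ε
  with e (½ ℚ.* ε) (half-pos 0<ε) | f (½ ℚ.* ε) (half-pos 0<ε)
... | M , h | N , k = M ℕ.⊔ N , λ n ≤n →
  trans-close (seq x n) (seq y n) (seq z n) (h n (⊔-left ≤n)) (k n (⊔-right {M} ≤n))

+-cong : ∀ {x x′ y y′} → x ≃ x′ → y ≃ y′ → x + y ≃ x′ + y′
+-cong {x} {x′} {y} {y′} e f ε 0<ε
  with e (½ ℚ.* ε) (half-pos 0<ε) | f (½ ℚ.* ε) (half-pos 0<ε)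
... | M , h | N , k = M ℕ.⊔ N , λ n ≤n →
  +-close (seq x n) (seq y n) (seq x′ n) (seq y′ n) (h n (⊔-left ≤n)) (k n (⊔-right {M} ≤n))

-‿cong : ∀ {x x′} → x ≃ x′ → - x ≃ - x′
-‿cong {x} {x′} e ε 0<ε with e ε 0<ε
... | N , h = N , λ n N≤n → neg-close (seq x n) (seq x′ n) (h n N≤n)

*-cong : ∀ {x x′ y y′} → x ≃ x′ → y ≃ y′ → x * y ≃ x′ * y′
*-cong {x} {x′} {y} {y′} e f ε 0<ε =
  let B , 0<B , K , hB = bound x′
      A , 0<A , L , hA = bound y
      δ  , 0<δ  , eA = quotient (half-pos 0<ε) 0<A
      δ′ , 0<δ′ , eB = quotient (half-pos 0<ε) 0<B
      M , h = e δ 0<δ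
      N , k = f δ′ 0<δ′
  in (K ℕ.⊔ L) ℕ.⊔ (M ℕ.⊔ N) , λ n ≤n →
    *-close (seq x n) (seq y n) (seq x′ n) (seq y′ n) 0<A 0<B eA eB
      (hA n (⊔-right {K} (⊔-left ≤n)))
      (hB n (⊔-left (⊔-left ≤n)))
      (h n (⊔-left (⊔-right {K ℕ.⊔ L} ≤n)))
      (k n (⊔-right {M} (⊔-right {K ℕ.⊔ L} ≤n)))

ℝ-commutativeRing : CommutativeRing 0ℓ 0ℓ
ℝ-commutativeRing = record
  { Carrier = ℝ ; _≈_ = _≃_ ; _+_ = _+_ ; _*_ = _*_ ; -_ = -_ ; 0# = 0# ; 1# = 1#
  ; isCommutativeRing = record
    { isRing = record
      { +-isAbelianGroup = record
        { isGroup = record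
          { isMonoid = record
            { isSemigroup = record
              { isMagma = record
                { isEquivalence = record
                  { refl  = λ {x} → pointwise x x λ _ → refl
                  ; sym   = λ {x} {y} → ≃-sym {x} {y}
                  ; trans = λ {x} {y} {z} → ≃-trans {x} {y} {z}
                  }
                ; ∙-cong = λ {x} {x′} {y} {y′} → +-cong {x} {x′} {y} {y′}
                }
              ; assoc = λ x y z → pointwise (x + y + z) (x + (y + z))
                          λ n → ℚₚ.+-assoc (seq x n) (seq y n) (seq z n)
              }
            ; identity = (λ x → pointwise (0# + x) x λ n → ℚₚ.+-identityˡ (seq x n))
                       , (λ x → pointwise (x + 0#) x λ n → ℚₚ.+-identityʳ (seq x n))
            }
          ; inverse = (λ x → pointwise (- x + x) 0# λ n → ℚₚ.+-inverseˡ (seq x n))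
                    , (λ x → pointwise (x + - x) 0# λ n → ℚₚ.+-inverseʳ (seq x n))
          ; ⁻¹-cong = λ {x} {x′} → -‿cong {x} {x′}
          }
        ; comm = λ x y → pointwise (x + y) (y + x) λ n → ℚₚ.+-comm (seq x n) (seq y n)
        }
      ; *-cong = λ {x} {x′} {y} {y′} → *-cong {x} {x′} {y} {y′}
      ; *-assoc = λ x y z → pointwise (x * y * z) (x * (y * z))
                    λ n → ℚₚ.*-assoc (seq x n) (seq y n) (seq z n)
      ; *-identity = (λ x → pointwise (1# * x) x λ n → ℚₚ.*-identityˡ (seq x n))
                   , (λ x → pointwise (x * 1#) x λ n → ℚₚ.*-identityʳ (seq x n))
      ; distrib = (λ x y z → pointwise (x * (y + z)) (x * y + x * z)
                     λ n → ℚₚ.*-distribˡ-+ (seq x n) (seq y n) (seq z n))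
                , (λ x y z → pointwise ((y + z) * x) (y * x + z * x)
                     λ n → ℚₚ.*-distribʳ-+ (seq x n) (seq y n) (seq z n))
      }
    ; *-comm = λ x y → pointwise (x * y) (y * x) λ n → ℚₚ.*-comm (seq x n) (seq y n)
    }
  }

open import Algebra.Definitions.RawSemiring (Semiring.rawSemiring (CommutativeRing.semiring ℝ-commutativeRing)) public
  using (sum; product; _^_)

------------------------------------------------------------------------
-- A polynomial is a formal finite sum of terms c·x^α; the same exponent
-- may occur several times, and two polynomials are identified when all
-- their coefficients agree.

Exponent : ℕ → Set
Exponent n = Vec ℕ n

∣_∣ₑ : ∀ {n} → Exponent n → ℕ
∣ α ∣ₑ = Vec.sum α

Poly : ℕ → Set
Poly n = List (ℝ × Exponent n)

monomial : ∀ {n} → ℝ → Exponent n → Poly n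
monomial c α = (c , α) ∷ []

infixl 6 _+ₚ_
infixl 7 _*ₚ_ _·ₚ_
infix  4 _≈ₚ_

_+ₚ_ : ∀ {n} → Poly n → Poly n → Poly n
_+ₚ_ = _++_

_*ₚ_ : ∀ {n} → Poly n → Poly n → Poly n
_*ₚ_ = cartesianProductWith λ (a , α) (b , β) → a * b , Vec.zipWith ℕ._+_ α β

_·ₚ_ : ∀ {n} → ℝ → Poly n → Poly n
c ·ₚ p = List.map (λ (a , α) → c * a , α) p

sumₚ : ∀ {n k} → (Fin k → Poly n) → Poly n
sumₚ ps = List.concat (List.tabulate ps)

coeff : ∀ {n} → Poly n → Exponent n → ℝ
coeff []            γ = 0#
coeff ((c , α) ∷ p) γ with Vecₚ.≡-dec ℕₚ._≟_ α γ
... | yes _ = c + coeff p γ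
... | no  _ = coeff p γ

_≈ₚ_ : ∀ {n} → Poly n → Poly n → Set
p ≈ₚ q = ∀ γ → coeff p γ ≃ coeff q γ

degree≤ : ∀ {n} → ℕ → Poly n → Set
degree≤ D p = ∀ γ → D ℕ.< ∣ γ ∣ₑ → coeff p γ ≃ 0#

eval : ∀ {n} → Poly n → Vector ℝ n → ℝ
eval []            x = 0#
eval ((c , α) ∷ p) x = c * product (λ i → x i ^ Vec.lookup α i) + eval p x

Nonnegative : ∀ {n} → Poly n → Set
Nonnegative p = ∀ x → 0# ≤ eval p x

------------------------------------------------------------------------

point : ∀ {n} → Exponent n → Vector ℝ n
point α i = fromℕ (Vec.lookup α i)

combination : ∀ {n m} → Vector ℝ m → Vector (Vector ℝ n) m → Vector ℝ n
combination t v i = sum (λ j → t j * v j i)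

AffinelyIndependent : ∀ {n m} → Vector (Vector ℝ n) m → Set
AffinelyIndependent v =
  ∀ t → sum t ≃ 0# → (∀ i → combination t v i ≃ 0#) → ∀ j → t j ≃ 0#

InAffineHull : ∀ {n m} → Vector (Vector ℝ n) m → Vector ℝ n → Set
InAffineHull v y = ∃ λ t → sum t ≃ 1# × (∀ i → combination t v i ≃ y i)

InConvexHull : ∀ {n m} → Vector (Vector ℝ n) m → Vector ℝ n → Set
InConvexHull v y =
  ∃ λ t → (∀ j → 0# ≤ t j) × sum t ≃ 1# × (∀ i → combination t v i ≃ y i)

-- Relative interior of conv v, i.e. its interior inside its affine hull
-- (which is that of v).  Open cubes serve as the basic neighbourhoods.
InRelativeInterior : ∀ {n m} → Vector (Vector ℝ n) m → Vector ℝ n → Set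
InRelativeInterior v y =
  InConvexHull v y ×
  ∃ λ ε → 0# < ε ×
    (∀ z → InAffineHull v z → (∀ i → y i + - ε < z i × z i < y i + ε) → InConvexHull v z)

------------------------------------------------------------------------

-- When r = 0 the relative interior is the single point α(0), so β = α(0);
-- monomial squares arise this way with fβ = 0.
record IsCircuit {n : ℕ} (f : Poly n) : Set where
  field
    r         : ℕ
    r≤n       : r ℕ.≤ n
    α         : Fin (suc r) → Exponent n
    β         : Exponent n
    fα        : Fin (suc r) → ℝ
    fβ        : ℝ
    form      : f ≈ₚ sumₚ (λ j → monomial (fα j) (α j)) +ₚ monomial fβ β
    fα-pos    : ∀ j → 0# < fα j
    α-even    : ∀ j i → 2 ∣ Vec.lookup (α j) i
    α-indep   : AffinelyIndependent (λ j → point (α j))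
    β-relint  : InRelativeInterior (λ j → point (α j)) (point β)

-- SONC n D f means f ∈ C_{n,D}.
record SONC (n D : ℕ) (f : Poly n) : Set where
  field
    deg        : degree≤ D f
    k          : ℕ
    k≥1        : 1 ℕ.≤ k
    μ          : Fin k → ℝ
    q          : Fin k → Poly n
    μ-nonneg   : ∀ i → 0# ≤ μ i
    q-circuit  : ∀ i → IsCircuit (q i)
    q-nonneg   : ∀ i → Nonnegative (q i)
    form       : f ≈ₚ sumₚ (λ i → μ i ·ₚ q i)

{-# OPTIONS --safe #-}

-- Take p₁ = (1 − x₀)² and p₂ = (4 − x₀)², which are nonnegative circuit
-- polynomials. For a circuit polynomial f with inner exponent β, a point x and
-- M = x^β, expanding in the vertex terms gives
--   M² f(1,…,1) + f(x²) − 2 M f(x) = Σⱼ cⱼ (M − x^α(j))² ≥ 0,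
-- where x² is taken coordinatewise. Hence a SONC polynomial that vanishes at
-- (1,…,1) and (4,…,4) is also nonpositive at (2,…,2). But p₁ p₂ vanishes at
-- the first two points and equals 4 at the third.

module Submission where

open import Level using (0ℓ)
open import Algebra.Bundles using (CommutativeRing)
import Algebra.Morphism.RingMonomorphism as RingMonomorphism
import Algebra.Properties.CommutativeMonoid.Sum as BigOperator
import Algebra.Properties.CommutativeSemiring.Exp as Exponentiation
import Algebra.Properties.Semiring.Sum as Summation
open import Data.Fin.Base using (Fin; zero; suc)
open import Data.List.Base as List using (List; []; _∷_; _++_)
open import Data.List.Membership.Propositional using (_∈_)
open import Data.List.Membership.Propositional.Properties using (∈-map⁺; ∈-++⁺ˡ; ∈-++⁺ʳ)
open import Data.List.Relation.Unary.All as All using (All; []; _∷_)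
import Data.List.Relation.Unary.All.Properties as Allₚ
open import Data.List.Relation.Unary.Any using (here; there)
open import Data.Nat.Base as ℕ using (ℕ; zero; suc)
open import Data.Nat.Divisibility using (_∣_; divides)
import Data.Nat.Properties as ℕₚ
open import Data.Product using (Σ-syntax; _×_; _,_; proj₁; proj₂)
open import Data.Rational.Base as ℚ using (0ℚ; 1ℚ; ½)
import Data.Rational.Properties as ℚₚ
open import Data.Rational.Solver using (module +-*-Solver)
open import Data.Sum.Base using (inj₁; inj₂)
open import Data.Vec.Base as Vec using ([]; _∷_)
import Data.Vec.Properties as Vecₚ
open import Data.Vec.Functional using (Vector)
open import Function.Base using (_∘_; id)
open import Relation.Binary.Bundles using (Preorder)
open import Relation.Binary.PropositionalEquality as ≡ using (_≡_; refl; cong; subst)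
import Relation.Binary.Reasoning.Preorder as PreorderReasoning
open import Relation.Nullary using (¬_; yes; no; ¬?; contradiction)
open import Relation.Nullary.Decidable using (from-yes; from-no)
open import Defs

open +-*-Solver

-- _≃_ and _≤_ unfold to statements about the underlying sequences, from which
-- their arguments cannot be inferred; the records below do not unfold.

infix 4 _≈_ _≲_

record _≈_ (x y : ℝ) : Set where
  constructor mk≈
  field ≈⇒≃ : x ≃ y

record _≲_ (x y : ℝ) : Set where
  constructor mk≲
  field ≲⇒≤ : x ≤ y

open _≈_
open _≲_

-- The identity carries `_≈_` to `_≃_` and back, so it is an injective ring homomorphism, along
-- which all ring laws transfer at once.
ring : CommutativeRing 0ℓ 0ℓ
ring = record
  { isCommutativeRing = RingMonomorphism.isCommutativeRing
      {R₁ = record { _≈_ = _≈_ ; _+_ = _+_ ; _*_ = _*_ ; -_ = -_ ; 0# = 0# ; 1# = 1# }}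
      {⟦_⟧ = id}
      (record
        { isRingHomomorphism = record
          { isSemiringHomomorphism = record
            { isNearSemiringHomomorphism = record
              { +-isMonoidHomomorphism = record
                { isMagmaHomomorphism = record
                  { isRelHomomorphism = record { cong = ≈⇒≃ }
                  ; homo = λ x y → R.refl {x + y}
                  }
                ; ε-homo = R.refl {0#}
                }
              ; *-homo = λ x y → R.refl {x * y}
              }
            ; 1#-homo = R.refl {1#}
            }
          ; -‿homo = λ x → R.refl { - x}
          }
        ; injective = mk≈
        })
      R.isCommutativeRing
  }
  where module R = CommutativeRing ℝ-commutativeRing

module ℝR = CommutativeRing ring
module ∏ = BigOperator ℝR.*-commutativeMonoid
module ∑ = Summation ℝR.semiring
module Pow = Exponentiation (CommutativeRing.commutativeSemiring ℝ-commutativeRing)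

-- Order and arithmetic of Cauchy reals

pointwise-≈ : ∀ {x y} → (∀ n → seq x n ≡ seq y n) → x ≈ y
pointwise-≈ {x} {y} h = mk≈ (pointwise x y h)

pointwise-≲ : ∀ {x y} → (∀ n → seq x n ℚ.≤ seq y n) → x ≲ y
pointwise-≲ {y = y} h = mk≲ λ ε 0<ε → 0 , λ n _ →
  ℚₚ.≤-trans (h n) (ℚₚ.≤-trans (ℚₚ.≤-reflexive (≡.sym (ℚₚ.+-identityʳ (seq y n))))
                                (ℚₚ.+-monoʳ-≤ (seq y n) (ℚₚ.<⇒≤ 0<ε)))

p≤∣p∣ : ∀ p → p ℚ.≤ ℚ.∣ p ∣
p≤∣p∣ p with ℚₚ.≤-total 0ℚ p
... | inj₁ 0≤p = ℚₚ.≤-reflexive (≡.sym (ℚₚ.0≤p⇒∣p∣≡p 0≤p))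
... | inj₂ p≤0 = ℚₚ.≤-trans p≤0 (ℚₚ.0≤∣p∣ p)

q≤p+∣q-p∣ : ∀ p q {ε} → ℚ.∣ q ℚ.- p ∣ ℚ.≤ ε → q ℚ.≤ p ℚ.+ ε
q≤p+∣q-p∣ p q {ε} h = begin
  q                       ≡⟨ solve 2 (λ p q → q := p :+ (q :- p)) refl p q ⟩
  p ℚ.+ (q ℚ.- p)         ≤⟨ ℚₚ.+-monoʳ-≤ p (p≤∣p∣ (q ℚ.- p)) ⟩
  p ℚ.+ ℚ.∣ q ℚ.- p ∣     ≤⟨ ℚₚ.+-monoʳ-≤ p h ⟩
  p ℚ.+ ε                 ∎
  where open ℚₚ.≤-Reasoning

≈⇒≲ : ∀ {x y} → x ≈ y → x ≲ y
≈⇒≲ {x} {y} (mk≈ x≃y) = mk≲ λ ε 0<ε → let N , h = x≃y ε 0<ε in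
  N , λ n N≤n → q≤p+∣q-p∣ (seq y n) (seq x n) (h n N≤n)

≲-trans : ∀ {x y z} → x ≲ y → y ≲ z → x ≲ z
≲-trans {x} {y} {z} (mk≲ x≤y) (mk≲ y≤z) = mk≲ λ ε 0<ε →
  let M , h = x≤y (½ ℚ.* ε) (half-pos 0<ε)
      N , k = y≤z (½ ℚ.* ε) (half-pos 0<ε)
  in M ℕ.⊔ N , λ n ≤n → begin
    seq x n                               ≤⟨ h n (⊔-left ≤n) ⟩
    seq y n ℚ.+ ½ ℚ.* ε                   ≤⟨ ℚₚ.+-monoˡ-≤ (½ ℚ.* ε) (k n (⊔-right {M} ≤n)) ⟩
    seq z n ℚ.+ ½ ℚ.* ε ℚ.+ ½ ℚ.* ε       ≡⟨ ℚₚ.+-assoc (seq z n) (½ ℚ.* ε) (½ ℚ.* ε) ⟩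
    seq z n ℚ.+ (½ ℚ.* ε ℚ.+ ½ ℚ.* ε)     ≡⟨ cong (seq z n ℚ.+_) (halves ε) ⟩
    seq z n ℚ.+ ε                         ∎
  where open ℚₚ.≤-Reasoning

≲-preorder : Preorder 0ℓ 0ℓ 0ℓ
≲-preorder = record
  { _≲_ = _≲_
  ; isPreorder = record
    { isEquivalence = ℝR.isEquivalence ; reflexive = ≈⇒≲ ; trans = ≲-trans }
  }

≲-refl : ∀ {x} → x ≲ x
≲-refl = ≈⇒≲ ℝR.refl

open PreorderReasoning ≲-preorder

+-mono-≲ : ∀ {x y u v} → x ≲ y → u ≲ v → x + u ≲ y + v
+-mono-≲ {x} {y} {u} {v} (mk≲ x≤y) (mk≲ u≤v) = mk≲ λ ε 0<ε →
  let M , h = x≤y (½ ℚ.* ε) (half-pos 0<ε)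
      N , k = u≤v (½ ℚ.* ε) (half-pos 0<ε)
  in M ℕ.⊔ N , λ n ≤n → ℚₚ.≤-trans
    (ℚₚ.+-mono-≤ (h n (⊔-left ≤n)) (k n (⊔-right {M} ≤n)))
    (ℚₚ.≤-reflexive (≡.trans
      (solve 3 (λ a b e → (a :+ e) :+ (b :+ e) := a :+ b :+ (e :+ e)) refl
        (seq y n) (seq v n) (½ ℚ.* ε))
      (cong (seq y n ℚ.+ seq v n ℚ.+_) (halves ε))))

<⇒≲ : ∀ {x y} → x < y → x ≲ y
<⇒≲ {x} {y} (δ , 0<δ , N , h) = mk≲ λ ε 0<ε → N , λ n N≤n →
  ℚₚ.≤-trans
    (subst (ℚ._≤ seq x n ℚ.+ δ) (ℚₚ.+-identityʳ (seq x n)) (ℚₚ.+-monoʳ-≤ (seq x n) (ℚₚ.<⇒≤ 0<δ)))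
    (ℚₚ.≤-trans (h n N≤n)
      (subst (ℚ._≤ seq y n ℚ.+ ε) (ℚₚ.+-identityʳ (seq y n)) (ℚₚ.+-monoʳ-≤ (seq y n) (ℚₚ.<⇒≤ 0<ε))))

0≤p*p : ∀ p → 0ℚ ℚ.≤ p ℚ.* p
0≤p*p p with ℚₚ.≤-total 0ℚ p
... | inj₁ 0≤p = ℚₚ.nonNegative⁻¹ _ {{ℚₚ.nonNeg*nonNeg⇒nonNeg p {{ℚ.nonNegative 0≤p}} p {{ℚ.nonNegative 0≤p}}}}
... | inj₂ p≤0 = ℚₚ.nonNegative⁻¹ _ {{ℚₚ.nonPos*nonPos⇒nonPos p {{ℚ.nonPositive p≤0}} p {{ℚ.nonPositive p≤0}}}}

-- The sign of a Cauchy real cannot be decided, so the case split on signs is made on the rational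
-- entries.
0≲x*x : ∀ x → 0# ≲ x * x
0≲x*x x = pointwise-≲ λ n → 0≤p*p (seq x n)

-- From x ≥ −δ and y ≥ −δ′, (x + δ)(y + δ′) ≥ 0 bounds x y below by
-- −δ y − δ′ (x + δ); so δ is fitted to a bound of y, and then δ′ to one of x + δ.
0≲x*y : ∀ {x y} → 0# ≲ x → 0# ≲ y → 0# ≲ x * y
0≲x*y {x} {y} (mk≲ 0≤x) (mk≲ 0≤y) = mk≲ λ ε 0<ε →
  let B , 0<B , K , hB = bound y
      A , 0<A , L , hA = bound x
      δ  , 0<δ  , eδ  = quotient (half-pos 0<ε) 0<B
      δ′ , 0<δ′ , eδ′ = quotient (half-pos 0<ε) (ℚₚ.+-mono-< 0<A 0<δ)
      M , h = 0≤x δ 0<δ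
      N , k = 0≤y δ′ 0<δ′
  in (K ℕ.⊔ L) ℕ.⊔ (M ℕ.⊔ N) , λ n ≤n →
    lower (seq x n) (seq y n) 0<δ 0<δ′ eδ eδ′
      (hA n (⊔-right {K} (⊔-left ≤n))) (hB n (⊔-left (⊔-left ≤n)))
      (h n (⊔-left (⊔-right {K ℕ.⊔ L} ≤n))) (k n (⊔-right {M} (⊔-right {K ℕ.⊔ L} ≤n)))
  where
  lower : ∀ {ε A B δ δ′} a b → 0ℚ ℚ.< δ → 0ℚ ℚ.< δ′ →
          B ℚ.* δ ≡ ½ ℚ.* ε → (A ℚ.+ δ) ℚ.* δ′ ≡ ½ ℚ.* ε →
          ℚ.∣ a ∣ ℚ.≤ A → ℚ.∣ b ∣ ℚ.≤ B → 0ℚ ℚ.≤ a ℚ.+ δ → 0ℚ ℚ.≤ b ℚ.+ δ′ →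
          0ℚ ℚ.≤ a ℚ.* b ℚ.+ ε
  lower {ε} {A} {B} {δ} {δ′} a b 0<δ 0<δ′ eδ eδ′ a≤A b≤B 0≤a+δ 0≤b+δ′ = Q.begin
    0ℚ
      Q.≤⟨ ℚₚ.nonNegative⁻¹ _ {{ℚₚ.nonNeg*nonNeg⇒nonNeg (a ℚ.+ δ) {{ℚ.nonNegative 0≤a+δ}}
                                                  (b ℚ.+ δ′) {{ℚ.nonNegative 0≤b+δ′}}}} ⟩
    (a ℚ.+ δ) ℚ.* (b ℚ.+ δ′)
      Q.≡⟨ solve 4 (λ a b d e → (a :+ d) :* (b :+ e) := a :* b :+ (b :* d :+ (a :+ d) :* e))
             refl a b δ δ′ ⟩
    a ℚ.* b ℚ.+ (b ℚ.* δ ℚ.+ (a ℚ.+ δ) ℚ.* δ′)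
      Q.≤⟨ ℚₚ.+-monoʳ-≤ (a ℚ.* b) (ℚₚ.+-mono-≤
             (ℚₚ.*-monoʳ-≤-nonNeg δ {{ℚ.nonNegative (ℚₚ.<⇒≤ 0<δ)}} (ℚₚ.≤-trans (p≤∣p∣ b) b≤B))
             (ℚₚ.*-monoʳ-≤-nonNeg δ′ {{ℚ.nonNegative (ℚₚ.<⇒≤ 0<δ′)}}
               (ℚₚ.+-monoˡ-≤ δ (ℚₚ.≤-trans (p≤∣p∣ a) a≤A)))) ⟩
    a ℚ.* b ℚ.+ (B ℚ.* δ ℚ.+ (A ℚ.+ δ) ℚ.* δ′)
      Q.≡⟨ cong (a ℚ.* b ℚ.+_) (≡.cong₂ ℚ._+_ eδ eδ′) ⟩
    a ℚ.* b ℚ.+ (½ ℚ.* ε ℚ.+ ½ ℚ.* ε)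
      Q.≡⟨ cong (a ℚ.* b ℚ.+_) (halves ε) ⟩
    a ℚ.* b ℚ.+ ε Q.∎
    where module Q = ℚₚ.≤-Reasoning

x≲y⇒0≲y-x : ∀ {x y} → x ≲ y → 0# ≲ y + - x
x≲y⇒0≲y-x {x} {y} x≲y = begin
  0#        ≈⟨ ℝR.-‿inverseʳ x ⟨
  x + - x   ≲⟨ +-mono-≲ x≲y (≲-refl { - x}) ⟩
  y + - x   ∎

0≲y-x⇒x≲y : ∀ {x y} → 0# ≲ y + - x → x ≲ y
0≲y-x⇒x≲y {x} {y} 0≲y-x = begin
  x              ≈⟨ ℝR.+-identityˡ x ⟨
  0# + x         ≲⟨ +-mono-≲ 0≲y-x (≲-refl {x}) ⟩
  y + - x + x    ≈⟨ pointwise-≈ (λ n → solve 2 (λ x y → y :- x :+ x := y) refl (seq x n) (seq y n)) ⟩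
  y              ∎

*-monoˡ-≲ : ∀ {z x y} → 0# ≲ z → x ≲ y → z * x ≲ z * y
*-monoˡ-≲ {z} {x} {y} 0≲z x≲y = 0≲y-x⇒x≲y (begin
  0#                  ≲⟨ 0≲x*y 0≲z (x≲y⇒0≲y-x x≲y) ⟩
  z * (y + - x)       ≈⟨ pointwise-≈ (λ n →
                           solve 3 (λ x y z → z :* (y :- x) := z :* y :- z :* x) refl
                             (seq x n) (seq y n) (seq z n)) ⟩
  z * y + - (z * x)   ∎)

*-nonPosʳ : ∀ {z x} → 0# ≲ z → x ≲ 0# → z * x ≲ 0#
*-nonPosʳ {z} 0≲z x≲0 = ≲-trans (*-monoˡ-≲ 0≲z x≲0) (≈⇒≲ (ℝR.zeroʳ z))

0≲1 : 0# ≲ 1#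
0≲1 = pointwise-≲ λ _ → from-yes (0ℚ ℚₚ.≤? 1ℚ)

1≲x*y : ∀ {x y} → 1# ≲ x → 1# ≲ y → 1# ≲ x * y
1≲x*y {x} {y} 1≲x 1≲y = begin
  1#       ≲⟨ 1≲x ⟩
  x        ≈⟨ ℝR.*-identityʳ x ⟨
  x * 1#   ≲⟨ *-monoˡ-≲ (≲-trans 0≲1 1≲x) 1≲y ⟩
  x * y    ∎

1≲^ : ∀ {x} → 1# ≲ x → ∀ k → 1# ≲ x ^ k
1≲^ 1≲x zero    = ≲-refl
1≲^ 1≲x (suc k) = 1≲x*y 1≲x (1≲^ 1≲x k)

1≲product : ∀ {k} (z : Vector ℝ k) → (∀ i → 1# ≲ z i) → 1# ≲ product z
1≲product {zero}  z 1≲z = ≲-refl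
1≲product {suc k} z 1≲z = 1≲x*y (1≲z zero) (1≲product (z ∘ suc) (1≲z ∘ suc))

0≲sum : ∀ {k} (z : Vector ℝ k) → (∀ i → 0# ≲ z i) → 0# ≲ sum z
0≲sum {zero}  z 0≲z = ≲-refl
0≲sum {suc k} z 0≲z = begin
  0#                       ≈⟨ ℝR.+-identityˡ 0# ⟨
  0# + 0#                  ≲⟨ +-mono-≲ (0≲z zero) (0≲sum (z ∘ suc) (0≲z ∘ suc)) ⟩
  z zero + sum (z ∘ suc)   ∎

sum≲0 : ∀ {k} (z : Vector ℝ k) → (∀ i → z i ≲ 0#) → sum z ≲ 0#
sum≲0 {zero}  z z≲0 = ≲-refl
sum≲0 {suc k} z z≲0 = begin
  z zero + sum (z ∘ suc)   ≲⟨ +-mono-≲ (z≲0 zero) (sum≲0 (z ∘ suc) (z≲0 ∘ suc)) ⟩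
  0# + 0#                  ≈⟨ ℝR.+-identityˡ 0# ⟩
  0#                       ∎

term≲sum : ∀ {k} (z : Vector ℝ k) → (∀ i → 0# ≲ z i) → ∀ i → z i ≲ sum z
term≲sum z 0≲z zero = begin
  z zero                   ≈⟨ ℝR.+-identityʳ (z zero) ⟨
  z zero + 0#              ≲⟨ +-mono-≲ (≲-refl {z zero}) (0≲sum (z ∘ suc) (0≲z ∘ suc)) ⟩
  z zero + sum (z ∘ suc)   ∎
term≲sum z 0≲z (suc i) = begin
  z (suc i)                ≲⟨ term≲sum (z ∘ suc) (0≲z ∘ suc) i ⟩
  sum (z ∘ suc)            ≈⟨ ℝR.+-identityˡ (sum (z ∘ suc)) ⟨
  0# + sum (z ∘ suc)       ≲⟨ +-mono-≲ (0≲z zero) (≲-refl {sum (z ∘ suc)}) ⟩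
  z zero + sum (z ∘ suc)   ∎

-- Evaluation

infixr 8 _^ₑ_

_^ₑ_ : ∀ {n} → Vector ℝ n → Exponent n → ℝ
x ^ₑ α = product (λ i → x i ^ Vec.lookup α i)

^-homo-* : ∀ x j k → x ^ (j ℕ.+ k) ≈ x ^ j * x ^ k
^-homo-* x j k = mk≈ (Pow.^-homo-* x j k)

^-distrib-* : ∀ x y k → (x * y) ^ k ≈ x ^ k * y ^ k
^-distrib-* x y k = mk≈ (Pow.^-distrib-* x y k)

1^≈1 : ∀ k → 1# ^ k ≈ 1#
1^≈1 zero    = ℝR.refl
1^≈1 (suc k) = ℝR.trans (ℝR.*-identityˡ (1# ^ k)) (1^≈1 k)

1^ₑ≈1 : ∀ {n} (α : Exponent n) → (λ _ → 1#) ^ₑ α ≈ 1#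
1^ₑ≈1 []      = ℝR.refl
1^ₑ≈1 (k ∷ α) = ℝR.trans (ℝR.*-cong (1^≈1 k) (1^ₑ≈1 α)) (ℝR.*-identityˡ 1#)

^ₑ-zeroʳ : ∀ {n} (x : Vector ℝ n) → x ^ₑ Vec.replicate n 0 ≈ 1#
^ₑ-zeroʳ {zero}  x = ℝR.refl
^ₑ-zeroʳ {suc n} x = ℝR.trans (ℝR.*-identityˡ _) (^ₑ-zeroʳ (x ∘ suc))

^ₑ-homo-* : ∀ {n} (x : Vector ℝ n) α β → x ^ₑ Vec.zipWith ℕ._+_ α β ≈ x ^ₑ α * x ^ₑ β
^ₑ-homo-* x α β = ℝR.trans
  (∏.sum-cong-≋ λ i → subst (λ k → x i ^ k ≈ x i ^ Vec.lookup α i * x i ^ Vec.lookup β i)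
    (≡.sym (Vecₚ.lookup-zipWith ℕ._+_ i α β))
    (^-homo-* (x i) (Vec.lookup α i) (Vec.lookup β i)))
  -- `∏` is generic summation read in the multiplicative monoid, so this splits a product of
  -- pairwise products into two products.
  (∏.∑-distrib-+ (λ i → x i ^ Vec.lookup α i) (λ i → x i ^ Vec.lookup β i))

^ₑ-distrib-* : ∀ {n} (x y : Vector ℝ n) α → (λ i → x i * y i) ^ₑ α ≈ x ^ₑ α * y ^ₑ α
^ₑ-distrib-* x y α = ℝR.trans
  (∏.sum-cong-≋ λ i → ^-distrib-* (x i) (y i) (Vec.lookup α i))
  (∏.∑-distrib-+ (λ i → x i ^ Vec.lookup α i) (λ i → y i ^ Vec.lookup α i))

-- At the inner exponent of a circuit this gives the lower bound on `M` that `excess-nonPos`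
-- requires.
1≲^ₑ : ∀ {n} {x : Vector ℝ n} → (∀ i → 1# ≲ x i) → ∀ α → 1# ≲ x ^ₑ α
1≲^ₑ {x = x} 1≲x α = 1≲product _ (λ i → 1≲^ (1≲x i) (Vec.lookup α i))

eval-++ : ∀ {n} (p q : Poly n) x → eval (p +ₚ q) x ≈ eval p x + eval q x
eval-++ []            q x = ℝR.sym (ℝR.+-identityˡ (eval q x))
eval-++ ((c , α) ∷ p) q x = begin-equality
  c * x ^ₑ α + eval (p +ₚ q) x         ≈⟨ ℝR.+-cong (ℝR.refl {c * x ^ₑ α}) (eval-++ p q x) ⟩
  c * x ^ₑ α + (eval p x + eval q x)   ≈⟨ ℝR.+-assoc (c * x ^ₑ α) (eval p x) (eval q x) ⟨
  c * x ^ₑ α + eval p x + eval q x     ∎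

eval-· : ∀ {n} c (p : Poly n) x → eval (c ·ₚ p) x ≈ c * eval p x
eval-· c []            x = ℝR.sym (ℝR.zeroʳ c)
eval-· c ((d , α) ∷ p) x = begin-equality
  c * d * x ^ₑ α + eval (c ·ₚ p) x     ≈⟨ ℝR.+-cong (ℝR.*-assoc c d (x ^ₑ α)) (eval-· c p x) ⟩
  c * (d * x ^ₑ α) + c * eval p x      ≈⟨ ℝR.distribˡ c (d * x ^ₑ α) (eval p x) ⟨
  c * (d * x ^ₑ α + eval p x)          ∎

eval-sumₚ : ∀ {n k} (ps : Fin k → Poly n) x → eval (sumₚ ps) x ≈ sum (λ i → eval (ps i) x)
eval-sumₚ {k = zero}  ps x = ℝR.refl
eval-sumₚ {k = suc k} ps x = begin-equality
  eval (ps zero +ₚ sumₚ (ps ∘ suc)) x              ≈⟨ eval-++ (ps zero) (sumₚ (ps ∘ suc)) x ⟩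
  eval (ps zero) x + eval (sumₚ (ps ∘ suc)) x      ≈⟨ ℝR.+-cong (ℝR.refl {eval (ps zero) x}) (eval-sumₚ (ps ∘ suc) x) ⟩
  eval (ps zero) x + sum (λ i → eval (ps (suc i)) x) ∎

-- Definitional, but ℝ has η and its operations are given by copatterns, so that
-- Agda compares unequal terms of ℝ componentwise; naming the step keeps this cheap.
eval-∷ : ∀ {n} c α (p : Poly n) x → eval ((c , α) ∷ p) x ≈ c * x ^ₑ α + eval p x
eval-∷ c α p x = ℝR.refl {c * x ^ₑ α + eval p x}

eval-times : ∀ {n} c α (q : Poly n) x →
             eval (List.map (λ (d , β) → c * d , Vec.zipWith ℕ._+_ α β) q) x ≈ c * x ^ₑ α * eval q x
eval-times c α []            x = ℝR.sym (ℝR.zeroʳ (c * x ^ₑ α))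
eval-times {n} c α ((d , β) ∷ q) x = begin-equality
  eval (List.map times ((d , β) ∷ q)) x
    ≈⟨ eval-∷ (c * d) (Vec.zipWith ℕ._+_ α β) (List.map times q) x ⟩
  c * d * x ^ₑ Vec.zipWith ℕ._+_ α β + eval (List.map times q) x
    ≈⟨ ℝR.+-cong (ℝR.*-cong (ℝR.refl {c * d}) (^ₑ-homo-* x α β)) (eval-times c α q x) ⟩
  c * d * (x ^ₑ α * x ^ₑ β) + c * x ^ₑ α * eval q x
    ≈⟨ distribute (x ^ₑ α) (x ^ₑ β) (eval q x) ⟩
  c * x ^ₑ α * (d * x ^ₑ β + eval q x)
    ≈⟨ ℝR.*-cong (ℝR.refl {c * x ^ₑ α}) (eval-∷ d β q x) ⟨
  c * x ^ₑ α * eval ((d , β) ∷ q) x ∎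
  where
  times : ℝ × Exponent n → ℝ × Exponent n
  times (d , β) = c * d , Vec.zipWith ℕ._+_ α β

  distribute : ∀ a b e → c * d * (a * b) + c * a * e ≈ c * a * (d * b + e)
  distribute a b e = pointwise-≈ λ n → solve 5
    (λ c d a b e → c :* d :* (a :* b) :+ c :* a :* e := c :* a :* (d :* b :+ e)) refl
    (seq c n) (seq d n) (seq a n) (seq b n) (seq e n)

eval-*ₚ : ∀ {n} (p q : Poly n) x → eval (p *ₚ q) x ≈ eval p x * eval q x
eval-*ₚ []            q x = ℝR.sym (ℝR.zeroˡ (eval q x))
eval-*ₚ ((c , α) ∷ p) q x = begin-equality
  eval (((c , α) ∷ p) *ₚ q) x                        ≈⟨ eval-++ (List.map (λ (d , β) → c * d , Vec.zipWith ℕ._+_ α β) q) (p *ₚ q) x ⟩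
  eval (List.map (λ (d , β) → c * d , Vec.zipWith ℕ._+_ α β) q) x + eval (p *ₚ q) x
                                                     ≈⟨ ℝR.+-cong (eval-times c α q x) (eval-*ₚ p q x) ⟩
  c * x ^ₑ α * eval q x + eval p x * eval q x        ≈⟨ ℝR.distribʳ (eval q x) (c * x ^ₑ α) (eval p x) ⟨
  (c * x ^ₑ α + eval p x) * eval q x                 ≈⟨ ℝR.*-cong (eval-∷ c α p x) (ℝR.refl {eval q x}) ⟨
  eval ((c , α) ∷ p) x * eval q x                    ∎

-- Evaluation depends only on the coefficients

infixl 6 _without_

_without_ : ∀ {n} → Poly n → Exponent n → Poly n
p without α = List.filter (λ t → ¬? (Vecₚ.≡-dec ℕₚ._≟_ (proj₂ t) α)) p

-- An exponent may occur in several terms; `coeff p α` gathers them all, and `without` deletes them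
-- all.
eval-without : ∀ {n} (p : Poly n) α x → eval p x ≈ coeff p α * x ^ₑ α + eval (p without α) x
eval-without []            α x = pointwise-≈ λ n →
  solve 1 (λ a → con 0ℚ := con 0ℚ :* a :+ con 0ℚ) refl (seq (x ^ₑ α) n)
eval-without ((c , γ) ∷ p) α x with Vecₚ.≡-dec ℕₚ._≟_ γ α
... | yes refl = begin-equality
  c * x ^ₑ α + eval p x
    ≈⟨ ℝR.+-cong (ℝR.refl {c * x ^ₑ α}) (eval-without p α x) ⟩
  c * x ^ₑ α + (coeff p α * x ^ₑ α + eval (p without α) x)
    ≈⟨ pointwise-≈ (λ n → solve 4 (λ c a d e → c :* a :+ (d :* a :+ e) := (c :+ d) :* a :+ e) refl
         (seq c n) (seq (x ^ₑ α) n) (seq (coeff p α) n) (seq (eval (p without α) x) n)) ⟩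
  (c + coeff p α) * x ^ₑ α + eval (p without α) x ∎
... | no _ = begin-equality
  c * x ^ₑ γ + eval p x
    ≈⟨ ℝR.+-cong (ℝR.refl {c * x ^ₑ γ}) (eval-without p α x) ⟩
  c * x ^ₑ γ + (coeff p α * x ^ₑ α + eval (p without α) x)
    ≈⟨ pointwise-≈ (λ n → solve 3 (λ c d e → c :+ (d :+ e) := d :+ (c :+ e)) refl
         (seq (c * x ^ₑ γ) n) (seq (coeff p α * x ^ₑ α) n) (seq (eval (p without α) x) n)) ⟩
  coeff p α * x ^ₑ α + (c * x ^ₑ γ + eval (p without α) x) ∎

coeff-without-≡ : ∀ {n} (p : Poly n) α → coeff (p without α) α ≡ 0#
coeff-without-≡ []            α = refl
coeff-without-≡ ((c , γ) ∷ p) α with Vecₚ.≡-dec ℕₚ._≟_ γ α in eq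
... | yes _ = coeff-without-≡ p α
-- Once the head survives the filter, `coeff` asks the same question about `γ` and `α` again, out of
-- reach of the first `with`; `eq` answers it.
... | no  _ rewrite eq = coeff-without-≡ p α

coeff-without-≢ : ∀ {n} (p : Poly n) {α γ} → α ≡.≢ γ → coeff (p without α) γ ≡ coeff p γ
coeff-without-≢ []            α≢γ = refl
coeff-without-≢ ((c , δ) ∷ p) {α} {γ} α≢γ
  with Vecₚ.≡-dec ℕₚ._≟_ δ α | Vecₚ.≡-dec ℕₚ._≟_ δ γ in eq
... | yes refl | yes refl = contradiction refl α≢γ
... | yes refl | no  _    = coeff-without-≢ p α≢γ
... | no  _    | yes _    rewrite eq = cong (c +_) (coeff-without-≢ p α≢γ)
... | no  _    | no  _    rewrite eq = coeff-without-≢ p α≢γ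

without-cong : ∀ {n} (p q : Poly n) α → p ≈ₚ q → p without α ≈ₚ q without α
without-cong p q α p≈q γ with Vecₚ.≡-dec ℕₚ._≟_ α γ
... | yes refl = ≡.subst₂ _≃_ (≡.sym (coeff-without-≡ p α)) (≡.sym (coeff-without-≡ q α))
                   (≈⇒≃ (ℝR.refl {0#}))
... | no  α≢γ  = ≡.subst₂ _≃_ (≡.sym (coeff-without-≢ p α≢γ)) (≡.sym (coeff-without-≢ q α≢γ)) (p≈q γ)

-- A finite list containing all exponents that occur. It is the induction measure of `eval-cong`,
-- where it must cover two polynomials at once.
Supported : ∀ {n} → List (Exponent n) → Poly n → Set
Supported L = All (λ t → proj₂ t ∈ L)

Supported-without : ∀ {n} {α : Exponent n} {L p} → Supported (α ∷ L) p → Supported L (p without α)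
Supported-without {α = α} {p = p} s =
  All.zipWith (λ where (here γ≡α , γ≢α) → contradiction γ≡α γ≢α
                       (there γ∈L , _)  → γ∈L)
    (Allₚ.filter⁺ _ s , Allₚ.all-filter (λ t → ¬? (Vecₚ.≡-dec ℕₚ._≟_ (proj₂ t) α)) p)

-- Equal coefficients say nothing about order or repetition of terms, so the two lists cannot be
-- traversed together. The induction runs over a list of exponents covering both: each step splits
-- off one exponent from both sides, and when the list is exhausted both polynomials are empty.
eval-cong : ∀ {n} (p q : Poly n) x → p ≈ₚ q → eval p x ≈ eval q x
eval-cong {n} p q x = on (List.map proj₂ (p ++ q)) p q
  (All.tabulate λ t∈p → ∈-map⁺ proj₂ (∈-++⁺ˡ t∈p))
  (All.tabulate λ t∈q → ∈-map⁺ proj₂ (∈-++⁺ʳ p t∈q))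
  where
  on : ∀ L (p q : Poly n) → Supported L p → Supported L q → p ≈ₚ q → eval p x ≈ eval q x
  on []      []      []      _        _        _   = ℝR.refl
  on []      (_ ∷ _) _       (() ∷ _) _        _
  on []      []      (_ ∷ _) _        (() ∷ _) _
  on (α ∷ L) p       q       s        t        p≈q = begin-equality
    eval p x                                       ≈⟨ eval-without p α x ⟩
    coeff p α * x ^ₑ α + eval (p without α) x      ≈⟨ ℝR.+-cong
      (ℝR.*-cong (mk≈ {coeff p α} {coeff q α} (p≈q α)) (ℝR.refl {x ^ₑ α}))
      (on L (p without α) (q without α) (Supported-without s) (Supported-without t) (without-cong p q α p≈q)) ⟩
    coeff q α * x ^ₑ α + eval (q without α) x      ≈⟨ eval-without q α x ⟨
    eval q x                                       ∎

-- The circuit inequality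

squares : ∀ {n} → Vector ℝ n → Vector ℝ n
squares x i = x i * x i

ones : ∀ {n} → Vector ℝ n
ones _ = 1#

-- The arguments `u`, `v`, `w` stand for the values at (1,...,1), at the squared point and at the
-- point itself. For fixed `M` the expression is linear in them, which allows the gap of a
-- polynomial to be computed term by term.
excess : ℝ → ℝ → ℝ → ℝ → ℝ
excess M u v w = M * M * u + v + - (M * w + M * w)

excess-cong : ∀ M {u u′ v v′ w w′} → u ≈ u′ → v ≈ v′ → w ≈ w′ → excess M u v w ≈ excess M u′ v′ w′
excess-cong M {u} {u′} {v} {v′} {w} {w′} u≈u′ v≈v′ w≈w′ = ℝR.+-cong
  (ℝR.+-cong (ℝR.*-cong (ℝR.refl {M * M}) u≈u′) v≈v′) (ℝR.-‿cong (ℝR.+-cong Mw≈Mw′ Mw≈Mw′))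
  where
  Mw≈Mw′ : M * w ≈ M * w′
  Mw≈Mw′ = ℝR.*-cong (ℝR.refl {M}) w≈w′

excess-+ : ∀ M u v w u′ v′ w′ →
           excess M (u + u′) (v + v′) (w + w′) ≈ excess M u v w + excess M u′ v′ w′
excess-+ M u v w u′ v′ w′ = pointwise-≈ λ n →
  solve 7 (λ M u v w u′ v′ w′ →
    M :* M :* (u :+ u′) :+ (v :+ v′) :+ :- (M :* (w :+ w′) :+ M :* (w :+ w′))
    := (M :* M :* u :+ v :+ :- (M :* w :+ M :* w)) :+ (M :* M :* u′ :+ v′ :+ :- (M :* w′ :+ M :* w′))) refl
    (seq M n) (seq u n) (seq v n) (seq w n) (seq u′ n) (seq v′ n) (seq w′ n)

excess-0 : ∀ M → excess M 0# 0# 0# ≈ 0#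
excess-0 M = pointwise-≈ λ n → solve 1 (λ M →
  M :* M :* con 0ℚ :+ con 0ℚ :+ :- (M :* con 0ℚ :+ M :* con 0ℚ) := con 0ℚ) refl (seq M n)

excess-square : ∀ M c m → excess M (c * 1#) (c * (m * m)) (c * m) ≈ c * ((M + - m) * (M + - m))
excess-square M c m = pointwise-≈ λ n → solve 3 (λ M c m →
  M :* M :* (c :* con 1ℚ) :+ c :* (m :* m) :+ :- (M :* (c :* m) :+ M :* (c :* m))
  := c :* ((M :+ :- m) :* (M :+ :- m))) refl (seq M n) (seq c n) (seq m n)

excess-scale : ∀ M μ u v w → μ * excess M u v w ≈ excess M (μ * u) (μ * v) (μ * w)
excess-scale M μ u v w = pointwise-≈ λ n → solve 5 (λ M μ u v w →
  μ :* (M :* M :* u :+ v :+ :- (M :* w :+ M :* w))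
  := M :* M :* (μ :* u) :+ μ :* v :+ :- (M :* (μ :* w) :+ M :* (μ :* w))) refl
  (seq M n) (seq μ n) (seq u n) (seq v n) (seq w n)

gap : ∀ {n} → Vector ℝ n → ℝ → Poly n → ℝ
gap x M p = excess M (eval p ones) (eval p (squares x)) (eval p x)

eval-monomial : ∀ {n} c (α : Exponent n) x → eval (monomial c α) x ≈ c * x ^ₑ α
eval-monomial c α x = ℝR.+-identityʳ (c * x ^ₑ α)

gap-monomial : ∀ {n} (x : Vector ℝ n) M c α →
               gap x M (monomial c α) ≈ c * ((M + - x ^ₑ α) * (M + - x ^ₑ α))
gap-monomial x M c α = ℝR.trans
  (excess-cong M {eval (monomial c α) ones} {c * 1#}
                 {eval (monomial c α) (squares x)} {c * (x ^ₑ α * x ^ₑ α)}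
                 {eval (monomial c α) x} {c * x ^ₑ α}
    (ℝR.trans (eval-monomial c α ones) (ℝR.*-cong (ℝR.refl {c}) (1^ₑ≈1 α)))
    (ℝR.trans (eval-monomial c α (squares x)) (ℝR.*-cong (ℝR.refl {c}) (^ₑ-distrib-* x x α)))
    (eval-monomial c α x))
  (excess-square M c (x ^ₑ α))

gap-++ : ∀ {n} (x : Vector ℝ n) M p q → gap x M (p +ₚ q) ≈ gap x M p + gap x M q
gap-++ x M p q = ℝR.trans
  (excess-cong M {eval (p +ₚ q) ones} {eval p ones + eval q ones}
                 {eval (p +ₚ q) (squares x)} {eval p (squares x) + eval q (squares x)}
                 {eval (p +ₚ q) x} {eval p x + eval q x}
    (eval-++ p q ones) (eval-++ p q (squares x)) (eval-++ p q x))
  (excess-+ M (eval p ones) (eval p (squares x)) (eval p x) (eval q ones) (eval q (squares x)) (eval q x))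

gap-cong : ∀ {n} (x : Vector ℝ n) M p q → p ≈ₚ q → gap x M p ≈ gap x M q
gap-cong x M p q p≈q = excess-cong M
  {eval p ones} {eval q ones} {eval p (squares x)} {eval q (squares x)} {eval p x} {eval q x}
  (eval-cong p q ones p≈q) (eval-cong p q (squares x) p≈q) (eval-cong p q x p≈q)

-- With this, a definitional equality is checked between polynomials and not between the components
-- of their gaps.
gap-≡ : ∀ {n} (x : Vector ℝ n) M {p q} → p ≡ q → gap x M p ≈ gap x M q
gap-≡ x M refl = ℝR.refl

0≲gap : ∀ {n} (x : Vector ℝ n) M p → All (λ t → 0# < proj₁ t) p → 0# ≲ gap x M p
0≲gap x M []            []         = ≈⇒≲ (ℝR.sym (excess-0 M))
0≲gap x M ((c , α) ∷ p) (0<c ∷ 0<p) = begin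
  0#                                          ≈⟨ ℝR.+-identityˡ 0# ⟨
  0# + 0#                                     ≲⟨ +-mono-≲ (0≲x*y (<⇒≲ 0<c) (0≲x*x (M + - x ^ₑ α)))
                                                          (0≲gap x M p 0<p) ⟩
  c * ((M + - x ^ₑ α) * (M + - x ^ₑ α)) + gap x M p
                                              ≈⟨ ℝR.+-cong (gap-monomial x M c α) (ℝR.refl {gap x M p}) ⟨
  gap x M (monomial c α) + gap x M p          ≈⟨ gap-++ x M (monomial c α) p ⟨
  gap x M (monomial c α +ₚ p)                 ≈⟨ gap-≡ x M {monomial c α +ₚ p} {(c , α) ∷ p} refl ⟩
  gap x M ((c , α) ∷ p)                       ∎

gap-inner : ∀ {n} (x : Vector ℝ n) c β → gap x (x ^ₑ β) (monomial c β) ≈ 0#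
gap-inner x c β = ℝR.trans (gap-monomial x (x ^ₑ β) c β)
  (pointwise-≈ λ n → solve 2 (λ c m → c :* ((m :+ :- m) :* (m :+ :- m)) := con 0ℚ) refl
    (seq c n) (seq (x ^ₑ β) n))

-- The term c x^α contributes c (M − x^α)² to the gap; at M = x^β the term in
-- x^β contributes nothing, so its sign does not matter.
0≲gap-+ : ∀ {n} (x : Vector ℝ n) c β p f → All (λ t → 0# < proj₁ t) p → f ≈ₚ p +ₚ monomial c β →
          0# ≲ gap x (x ^ₑ β) f
0≲gap-+ x c β p f 0<p f≈ = begin
  0#                                           ≲⟨ 0≲gap x (x ^ₑ β) p 0<p ⟩
  gap x (x ^ₑ β) p                             ≈⟨ ℝR.+-identityʳ (gap x (x ^ₑ β) p) ⟨
  gap x (x ^ₑ β) p + 0#                        ≈⟨ ℝR.+-cong (ℝR.refl {gap x (x ^ₑ β) p}) (gap-inner x c β) ⟨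
  gap x (x ^ₑ β) p + gap x (x ^ₑ β) (monomial c β)
                                               ≈⟨ gap-++ x (x ^ₑ β) p (monomial c β) ⟨
  gap x (x ^ₑ β) (p +ₚ monomial c β)           ≈⟨ gap-cong x (x ^ₑ β) f (p +ₚ monomial c β) f≈ ⟨
  gap x (x ^ₑ β) f                             ∎

0≲gap-circuit : ∀ {n} {f : Poly n} (C : IsCircuit f) x → 0# ≲ gap x (x ^ₑ IsCircuit.β C) f
0≲gap-circuit {f = f} C x =
  0≲gap-+ x fβ β (sumₚ λ j → monomial (fα j) (α j)) f
    (Allₚ.concat⁺ (Allₚ.tabulate⁺ λ j → _∷_ {x = fα j , α j} (fα-pos j) [])) form
  where open IsCircuit C

-- Nonnegativity of the excess says 2Mw ≤ M²u + v, whose right side is at most 0. Since M ≥ 1 and w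
-- ≥ 0, also w ≤ Mw ≤ 2Mw, so no division by `M` is involved.
excess-nonPos : ∀ {M u v w} → 1# ≲ M → 0# ≲ w → u ≲ 0# → v ≲ 0# → 0# ≲ excess M u v w → w ≲ 0#
excess-nonPos {M} {u} {v} {w} 1≲M 0≲w u≲0 v≲0 0≲ex = begin
  w                  ≈⟨ ℝR.*-identityʳ w ⟨
  w * 1#             ≲⟨ *-monoˡ-≲ 0≲w 1≲M ⟩
  w * M              ≈⟨ ℝR.*-comm w M ⟩
  M * w              ≈⟨ ℝR.+-identityʳ (M * w) ⟨
  M * w + 0#         ≲⟨ +-mono-≲ (≲-refl {M * w}) (0≲x*y (≲-trans 0≲1 1≲M) 0≲w) ⟩
  M * w + M * w      ≲⟨ 0≲y-x⇒x≲y 0≲ex ⟩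
  M * M * u + v      ≲⟨ +-mono-≲ (*-nonPosʳ (0≲x*x M) u≲0) v≲0 ⟩
  0# + 0#            ≈⟨ ℝR.+-identityˡ 0# ⟩
  0#                 ∎

gap-scale : ∀ {n} (x : Vector ℝ n) M μ p →
            μ * gap x M p ≈ excess M (μ * eval p ones) (μ * eval p (squares x)) (μ * eval p x)
gap-scale x M μ p = excess-scale M μ (eval p ones) (eval p (squares x)) (eval p x)

-- In a SONC sum only the weighted values `μ * eval f` are known to be nonpositive, and `μ` may be
-- zero. Hence the gap inequality is multiplied by `μ` instead of the values being divided by it.
circuit-nonPos : ∀ {n} {f : Poly n} → IsCircuit f → Nonnegative f → ∀ {μ x} → 0# ≲ μ → (∀ i → 1# ≲ x i) →
                 μ * eval f ones ≲ 0# → μ * eval f (squares x) ≲ 0# → μ * eval f x ≲ 0#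
circuit-nonPos {f = f} C 0≤f {μ} {x} 0≲μ 1≲x f₁≲0 f₂≲0 =
  excess-nonPos {x ^ₑ β} {μ * eval f ones} {μ * eval f (squares x)} {μ * eval f x}
    (1≲^ₑ 1≲x β) (0≲x*y {μ} {eval f x} 0≲μ (mk≲ {0#} {eval f x} (0≤f x))) f₁≲0 f₂≲0
    (≲-trans (0≲x*y {μ} {gap x (x ^ₑ β) f} 0≲μ (0≲gap-circuit C x))
             (≈⇒≲ (gap-scale x (x ^ₑ β) μ f)))
  where open IsCircuit C using (β)

-- Squares of linear polynomials

-- The exponent of x₀^k: the construction lives in the first variable alone.
ray : ∀ {n} → ℕ → Exponent (suc n)
ray k = k ∷ Vec.replicate _ 0

∣ray∣ : ∀ n k → ∣ ray {n} k ∣ₑ ≡ k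
∣ray∣ n k = ≡.trans (cong (k ℕ.+_) (sum-replicate-0 n)) (ℕₚ.+-identityʳ k)
  where
  sum-replicate-0 : ∀ n → Vec.sum (Vec.replicate n 0) ≡ 0
  sum-replicate-0 zero    = refl
  sum-replicate-0 (suc n) = sum-replicate-0 n

^ₑ-ray : ∀ {n} (x : Vector ℝ (suc n)) k → x ^ₑ ray k ≈ x zero ^ k
^ₑ-ray x k = ℝR.trans (ℝR.*-cong (ℝR.refl {x zero ^ k}) (^ₑ-zeroʳ (x ∘ suc))) (ℝR.*-identityʳ (x zero ^ k))

-- This is (a - x₀)² expanded. The inner term comes last, so that the list matches the shape
-- required of a circuit definitionally.
square : ∀ {n} → ℝ → Poly (suc n)
square a = (a * a , ray 0) ∷ (1# , ray 2) ∷ (- (a + a) , ray 1) ∷ []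

eval-square : ∀ {n} a (x : Vector ℝ (suc n)) → eval (square a) x ≈ (a + - x zero) * (a + - x zero)
eval-square {n} a x = begin-equality
  eval (square a) x
    ≈⟨ eval-∷ (a * a) (ray 0) tail₁ x ⟩
  a * a * x ^ₑ ray 0 + eval tail₁ x
    ≈⟨ ℝR.+-cong (ℝR.*-cong (ℝR.refl {a * a}) (^ₑ-ray x 0)) (eval-∷ 1# (ray 2) tail₂ x) ⟩
  a * a * x zero ^ 0 + (1# * x ^ₑ ray 2 + eval tail₂ x)
    ≈⟨ ℝR.+-cong (ℝR.refl {a * a * x zero ^ 0}) (ℝR.+-cong (ℝR.*-cong (ℝR.refl {1#}) (^ₑ-ray x 2))
         (ℝR.trans (eval-monomial (- (a + a)) (ray 1) x) (ℝR.*-cong (ℝR.refl { - (a + a)}) (^ₑ-ray x 1)))) ⟩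
  a * a * x zero ^ 0 + (1# * x zero ^ 2 + - (a + a) * x zero ^ 1)
    ≈⟨ pointwise-≈ (λ n → solve 2 (λ a x →
         a :* a :* con 1ℚ :+ (con 1ℚ :* (x :* (x :* con 1ℚ)) :+ :- (a :+ a) :* (x :* con 1ℚ))
         := (a :+ :- x) :* (a :+ :- x)) refl (seq a n) (seq (x zero) n)) ⟩
  (a + - x zero) * (a + - x zero) ∎
  where
  tail₁ tail₂ : Poly (suc n)
  tail₁ = (1# , ray 2) ∷ tail₂
  tail₂ = monomial (- (a + a)) (ray 1)

square-nonNeg : ∀ {n} a → Nonnegative (square {n} a)
square-nonNeg a x = ≲⇒≤ (≲-trans (0≲x*x (a + - x zero)) (≈⇒≲ (ℝR.sym (eval-square a x))))

-- The segment from x₀^0 to x₀^2 and its midpoint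

endpoints : ∀ {n} → Fin 2 → Exponent (suc n)
endpoints zero       = ray 0
endpoints (suc zero) = ray 2

-- Coordinate 0 of the combination of the endpoints is 2 t₁, so halving it recovers t₁; `offset`
-- then recovers t₀ from the sum of the weights. Both independence and the relative interior rest on
-- this.
slope : ∀ t₀ t₁ → t₁ ≈ fromℚ ½ * (t₀ * fromℕ 0 + (t₁ * fromℕ 2 + 0#))
slope t₀ t₁ = pointwise-≈ λ n → solve 2 (λ t₀ t₁ →
  t₁ := con ½ :* (t₀ :* con 0ℚ :+ (t₁ :* con (1ℚ ℚ.+ 1ℚ) :+ con 0ℚ))) refl (seq t₀ n) (seq t₁ n)

offset : ∀ t₀ t₁ → t₀ ≈ (t₀ + (t₁ + 0#)) + - t₁
offset t₀ t₁ = pointwise-≈ λ n → solve 2 (λ t₀ t₁ →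
  t₀ := (t₀ :+ (t₁ :+ con 0ℚ)) :+ :- t₁) refl (seq t₀ n) (seq t₁ n)

-- Coordinate 0 forces the weight of `ray 2` to vanish, and the sum of the weights then forces the
-- other.
endpoints-indep : ∀ {n} → AffinelyIndependent (λ j → point (endpoints {n} j))
endpoints-indep t ∑t≃0 h zero = ≈⇒≃ (begin-equality
  t zero                        ≈⟨ offset (t zero) (t (suc zero)) ⟩
  sum t + - t (suc zero)        ≈⟨ ℝR.+-cong (mk≈ {sum t} {0#} ∑t≃0)
                                     (ℝR.-‿cong (mk≈ {t (suc zero)} {0#} (endpoints-indep t ∑t≃0 h (suc zero)))) ⟩
  0# + - 0#                     ≈⟨ ℝR.-‿inverseʳ 0# ⟩
  0#                            ∎)
endpoints-indep t ∑t≃0 h (suc zero) = ≈⇒≃ (ℝR.trans (slope (t zero) (t (suc zero)))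
  (ℝR.trans (ℝR.*-cong (ℝR.refl {fromℚ ½}) (mk≈ (h zero))) (ℝR.zeroʳ (fromℚ ½))))

midpoint-relint : ∀ {n} → InRelativeInterior (λ j → point (endpoints {n} j)) (point (ray 1))
midpoint-relint {n} =
    ( (λ _ → fromℚ ½)
    , (λ _ → ≲⇒≤ (pointwise-≲ {0#} {fromℚ ½} λ _ → from-yes (0ℚ ℚₚ.≤? ½)))
    , pointwise (sum {2} λ _ → fromℚ ½) 1# (λ _ → refl)
    , midpoint )
  -- Radius 1 around the midpoint confines `z zero` to the open interval from 0 to 2, the first
  -- coordinates of the endpoints.
  , 1# , (1ℚ , from-yes (0ℚ ℚₚ.<? 1ℚ) , 0 , λ _ _ → ℚₚ.≤-refl)
  -- The affine weights of `z` already serve as convex weights: they are t₁ = z₀/2 and t₀ = (2 -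
  -- z₀)/2, nonnegative by the two bounds on z₀.
  , λ z (t , ∑t≃1 , h) box → t , nonNeg z t ∑t≃1 (h zero) (box zero) , ∑t≃1 , h
  where
  midpoint : ∀ i → combination (λ _ → fromℚ ½) (λ j → point (endpoints {n} j)) i ≃ point (ray 1) i
  midpoint zero    = pointwise (fromℚ ½ * fromℕ 0 + (fromℚ ½ * fromℕ 2 + 0#)) (fromℕ 1) λ _ → refl
  midpoint (suc i) rewrite Vecₚ.lookup-replicate i 0 =
    pointwise (fromℚ ½ * fromℕ 0 + (fromℚ ½ * fromℕ 0 + 0#)) (fromℕ 0) λ _ → refl

  nonNeg : ∀ (z : Vector ℝ (suc n)) t → sum t ≃ 1# →
           combination t (λ j → point (endpoints {n} j)) zero ≃ z zero →
           fromℕ 1 + - 1# < z zero × z zero < fromℕ 1 + 1# → ∀ j → 0# ≤ t j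
  nonNeg z t ∑t≃1 h (lower , upper) = λ { zero → ≲⇒≤ 0≲t₀ ; (suc zero) → ≲⇒≤ 0≲t₁ }
    where
    0≲½ : 0# ≲ fromℚ ½
    0≲½ = pointwise-≲ λ _ → from-yes (0ℚ ℚₚ.≤? ½)
    t₁≈½z : t (suc zero) ≈ fromℚ ½ * z zero
    t₁≈½z = ℝR.trans (slope (t zero) (t (suc zero))) (ℝR.*-cong (ℝR.refl {fromℚ ½}) (mk≈ h))

    0≲t₀ : 0# ≲ t zero
    0≲t₀ = begin
      0#                                          ≲⟨ 0≲x*y 0≲½ (x≲y⇒0≲y-x (<⇒≲ {z zero} {fromℕ 1 + 1#} upper)) ⟩
      fromℚ ½ * (fromℕ 1 + 1# + - z zero)         ≈⟨ pointwise-≈ (λ n → solve 1 (λ z →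
                                                       con ½ :* (con 1ℚ :+ con 1ℚ :+ :- z) := con 1ℚ :+ :- (con ½ :* z))
                                                       refl (seq (z zero) n)) ⟩
      1# + - (fromℚ ½ * z zero)                   ≈⟨ ℝR.+-cong (mk≈ {sum t} {1#} ∑t≃1) (ℝR.-‿cong t₁≈½z) ⟨
      sum t + - t (suc zero)                      ≈⟨ offset (t zero) (t (suc zero)) ⟨
      t zero                                      ∎
    0≲t₁ : 0# ≲ t (suc zero)
    0≲t₁ = begin
      0#                       ≲⟨ 0≲x*y 0≲½ (≲-trans (pointwise-≲ {0#} {fromℕ 1 + - 1#} λ _ → ℚₚ.≤-refl)
                                                      (<⇒≲ {fromℕ 1 + - 1#} {z zero} lower)) ⟩
      fromℚ ½ * z zero         ≈⟨ t₁≈½z ⟨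
      t (suc zero)             ∎

≡⇒≈ₚ : ∀ {n} {p q : Poly n} → p ≡ q → p ≈ₚ q
≡⇒≈ₚ {p = p} refl γ = ≈⇒≃ (ℝR.refl {coeff p γ})

-- The vertices are the exponents 0 and 2 of x₀ with weights a² and 1; the inner exponent 1 is their
-- midpoint. The hypothesis is the positivity of the constant term.
square-circuit : ∀ {n} a → 0# < a * a → IsCircuit (square {n} a)
square-circuit {n} a 0<a*a = record
  { r        = 1
  ; r≤n      = ℕ.s≤s ℕ.z≤n
  ; α        = endpoints
  ; β        = ray 1
  ; fα       = weights
  ; fβ       = - (a + a)
  ; form     = ≡⇒≈ₚ {q = sumₚ (λ j → monomial (weights j) (endpoints j)) +ₚ monomial (- (a + a)) (ray 1)} refl
  ; fα-pos   = λ where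
      zero       → 0<a*a
      (suc zero) → 1ℚ , from-yes (0ℚ ℚₚ.<? 1ℚ) , 0 , λ _ _ → ℚₚ.≤-refl
  ; α-even   = even
  ; α-indep  = endpoints-indep
  ; β-relint = midpoint-relint
  }
  where
  weights : Fin 2 → ℝ
  weights zero       = a * a
  weights (suc zero) = 1#

  even : ∀ j i → 2 ∣ Vec.lookup (endpoints {n} j) i
  even zero       zero    = divides 0 refl
  even (suc zero) zero    = divides 1 refl
  even zero       (suc i) = divides 0 (Vecₚ.lookup-replicate i 0)
  even (suc zero) (suc i) = divides 0 (Vecₚ.lookup-replicate i 0)

-- Membership of the squares in the SONC cone

terms⇒degree≤ : ∀ {n D} {p : Poly n} → All (λ t → ∣ proj₂ t ∣ₑ ℕ.≤ D) p → degree≤ D p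
terms⇒degree≤ []                                γ D<γ = ≈⇒≃ (ℝR.refl {0#})
terms⇒degree≤ {p = (_ , α) ∷ _} (α≤D ∷ p≤D) γ D<γ with Vecₚ.≡-dec ℕₚ._≟_ α γ
... | yes refl = contradiction α≤D (ℕₚ.<⇒≱ D<γ)
... | no  _    = terms⇒degree≤ p≤D γ D<γ

-- The right side is what `sumₚ` reduces to for a single summand of weight 1.
1·ₚ : ∀ {n} (p : Poly n) → p ≈ₚ (1# ·ₚ p) ++ []
1·ₚ p γ = ≈⇒≃ (on p)
  where
  on : ∀ p → coeff p γ ≈ coeff ((1# ·ₚ p) ++ []) γ
  on []            = ℝR.refl {0#}
  on ((c , α) ∷ p) with Vecₚ.≡-dec ℕₚ._≟_ α γ
  ... | yes _ = ℝR.+-cong (ℝR.sym (ℝR.*-identityˡ c)) (on p)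
  ... | no  _ = on p

circuit⇒SONC : ∀ {n D} {p : Poly n} → degree≤ D p → IsCircuit p → Nonnegative p → SONC n D p
circuit⇒SONC {p = p} deg circuit nonneg = record
  { deg = deg ; k = 1 ; k≥1 = ℕₚ.≤-refl ; μ = λ _ → 1# ; q = λ _ → p
  ; μ-nonneg = λ _ → ≲⇒≤ 0≲1 ; q-circuit = λ _ → circuit ; q-nonneg = λ _ → nonneg
  ; form = 1·ₚ p
  }

square-SONC : ∀ {n D} a → 0# < a * a → 2 ℕ.≤ D → SONC (suc n) D (square a)
square-SONC {n} {D} a 0<a*a 2≤D = circuit⇒SONC
  (terms⇒degree≤ {p = square a} (ray≤D ℕ.z≤n ∷ ray≤D ℕₚ.≤-refl ∷ ray≤D (ℕ.s≤s ℕ.z≤n) ∷ []))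
  (square-circuit a 0<a*a) (square-nonNeg a)
  where
  ray≤D : ∀ {k} → k ℕ.≤ 2 → ∣ ray {n} k ∣ₑ ℕ.≤ D
  ray≤D k≤2 = ℕₚ.≤-trans (ℕₚ.≤-reflexive (∣ray∣ n _)) (ℕₚ.≤-trans k≤2 2≤D)

-- The obstruction and the product that violates it

eval-SONC : ∀ {n D} {p : Poly n} (S : SONC n D p) x →
            eval p x ≈ sum (λ i → SONC.μ S i * eval (SONC.q S i) x)
eval-SONC {p = p} S x = ℝR.trans (eval-cong p (sumₚ λ i → μ i ·ₚ q i) x form)
  (ℝR.trans (eval-sumₚ (λ i → μ i ·ₚ q i) x) (∑.sum-cong-≋ λ i → eval-· (μ i) (q i) x))
  where open SONC S

-- Each summand has its own inner exponent and hence its own `M`, so the circuit inequality must be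
-- applied summand by summand. This is possible because all weighted summands are nonnegative: if
-- their sum is at most 0 at a point, so is each of them.
SONC-nonPos : ∀ {n D} {p : Poly n} → SONC n D p → ∀ {x} → (∀ i → 1# ≲ x i) →
              eval p ones ≲ 0# → eval p (squares x) ≲ 0# → eval p x ≲ 0#
SONC-nonPos {p = p} S {x} 1≲x p₁≲0 p₂≲0 = ≲-trans (≈⇒≲ (eval-SONC S x)) (sum≲0 _ λ i →
  circuit-nonPos (q-circuit i) (q-nonneg i) (0≲μ i) 1≲x (term≲0 ones p₁≲0 i) (term≲0 (squares x) p₂≲0 i))
  where
  open SONC S
  0≲μ : ∀ i → 0# ≲ μ i
  0≲μ i = mk≲ {0#} {μ i} (μ-nonneg i)

  term≲0 : ∀ y → eval p y ≲ 0# → ∀ i → μ i * eval (q i) y ≲ 0#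
  term≲0 y p≲0 i = begin
    μ i * eval (q i) y                  ≲⟨ term≲sum (λ i → μ i * eval (q i) y)
                                             (λ i → 0≲x*y (0≲μ i) (mk≲ {0#} {eval (q i) y} (q-nonneg i y))) i ⟩
    sum (λ i → μ i * eval (q i) y)      ≈⟨ eval-SONC S y ⟨
    eval p y                            ≲⟨ p≲0 ⟩
    0#                                  ∎

squares-product : ∀ {n} a b (x : Vector ℝ (suc n)) → eval (square a *ₚ square b) x ≈
                  (a + - x zero) * (a + - x zero) * ((b + - x zero) * (b + - x zero))
squares-product a b x = ℝR.trans (eval-*ₚ (square a) (square b) x)
  (ℝR.*-cong (eval-square a x) (eval-square b x))

product-not-SONC : ∀ {n D} → ¬ SONC (suc n) D (square 1# *ₚ square (fromℕ 4))
product-not-SONC {n} S = 4≰0 (≲-trans (≈⇒≲ (ℝR.sym (squares-product 1# (fromℕ 4) twos)))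
  (SONC-nonPos S {twos} (λ _ → pointwise-≲ {1#} {fromℕ 2} λ _ → from-yes (1ℚ ℚₚ.≤? seq (fromℕ 2) 0))
    -- The first factor has its root at 1 and the second at 4 = 2 · 2, the coordinate of
    -- `squares twos`. All the sequences are constant, so the zeros hold by computation.
    (vanishes ones (λ _ → refl)) (vanishes (squares twos) (λ _ → refl))))
  where
  twos : Vector ℝ (suc n)
  twos _ = fromℕ 2

  value : Vector ℝ (suc n) → ℝ
  value x = (1# + - x zero) * (1# + - x zero) * ((fromℕ 4 + - x zero) * (fromℕ 4 + - x zero))

  vanishes : ∀ x → (∀ k → seq (value x) k ≡ 0ℚ) → eval (square 1# *ₚ square (fromℕ 4)) x ≲ 0#
  vanishes x v≡0 = ≈⇒≲ (ℝR.trans (squares-product 1# (fromℕ 4) x) (pointwise-≈ v≡0))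

  4≰0 : ¬ value twos ≲ 0#
  -- The value is (1 - 2)² (4 - 2)² = 4, so tolerance 1 already refutes the inequality; the sequence
  -- is constant, so its entry at `N` is its entry at 0.
  4≰0 (mk≲ 4≤0) = let N , h = 4≤0 1ℚ (from-yes (0ℚ ℚₚ.<? 1ℚ)) in
    from-no (seq (value twos) 0 ℚₚ.≤? 0ℚ ℚ.+ 1ℚ) (h N ℕₚ.≤-refl)

lemma3p1 : ∀ (d n : ℕ) → 2 ∣ d → 2 ℕ.≤ d → 1 ℕ.≤ n →
    Σ[ p₁ ∈ Poly n ] Σ[ p₂ ∈ Poly n ] (SONC n d p₁ × SONC n d p₂ × ¬ SONC n (2 ℕ.* d) (p₁ *ₚ p₂))
lemma3p1 d (suc n) _ 2≤d _ =
    square 1# , square (fromℕ 4)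
  -- The rational gap 1 witnesses 0 < a² both for a = 1 and for a = 4.
  , square-SONC 1# (1ℚ , from-yes (0ℚ ℚₚ.<? 1ℚ) , 0 , λ _ _ → from-yes (0ℚ ℚ.+ 1ℚ ℚₚ.≤? 1ℚ ℚ.* 1ℚ)) 2≤d
  , square-SONC (fromℕ 4) (1ℚ , from-yes (0ℚ ℚₚ.<? 1ℚ) , 0 ,
      λ _ _ → from-yes (0ℚ ℚ.+ 1ℚ ℚₚ.≤? seq (fromℕ 4) 0 ℚ.* seq (fromℕ 4) 0)) 2≤d
  , product-not-SONC
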